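{- For every real $\eta>0$ and every integer $\Delta\ge 2$ there exist positive constants $\beta$ and $\kappa$ such that for all sufficiently large $n$ the following holds: for every graph $H\in\mathcal{H}_2^{\beta n}((1-\eta)n,\Delta)$ and every $k\le\kappa(n/\log n)^{1/\Delta}$, every $k$-bounded edge-colouring of the complete graph $K_n$ is $H$-polychromatic.
   Context: A graph on $m$ vertices has bandwidth at most $b$ if its vertices can be labelled $1,\dots,m$ so that $|i-j|\le b$ for every edge $ij$. $\mathcal{H}_2^{b}(m,\Delta)$ is the class of bipartite graphs on $m$ vertices with maximum degree at most $\Delta$ and bandwidth at most $b$. An edge-colouring $\phi$ of $K_n$ is $k$-bounded if no colour is used on more than $k$ edges. A copy of $H$ in $K_n$ is polychromatic if no colour appears on more than one of its edges, and $\phi$ is $H$-polychromatic if $K_n$ contains a polychromatic copy of $H$. -}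

module Defs where

open import Data.Nat using (ℕ; zero; suc; _≤_; _<_; ∣_-_∣)
open import Data.Bool using (Bool; true; false)
open import Data.Fin using (Fin; toℕ)
open import Data.List using (List; length; filter; allFin; concatMap; map)
open import Data.Product using (Σ; _×_; _,_; ∃; ∃-syntax)
open import Data.Sum using (_⊎_)
open import Data.Integer using (+_)
open import Data.Rational using (ℚ; _/_; 1ℚ) renaming (_*_ to _*ℚ_)
open import Relation.Binary.PropositionalEquality using (_≡_; _≢_)
open import Relation.Nullary using (¬_)
open import Data.Fin using (_<?_; _≟_)
open import Function.Bundles using (_↔_; Inverse)
open import Function.Definitions using (Injective)

ℕ→ℚ : ℕ → ℚ
ℕ→ℚ n = (+ n) / 1

_^ℚ_ : ℚ → ℕ → ℚ
q ^ℚ zero = 1ℚ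
q ^ℚ suc k = q *ℚ (q ^ℚ k)

record Graph (m : ℕ) : Set where
  field
    adj   : Fin m → Fin m → Bool
    sym   : ∀ i j → adj i j ≡ adj j i
    irrefl : ∀ i → adj i i ≡ false
open Graph public

Edge : ∀ {m} → Graph m → Fin m → Fin m → Set
Edge G i j = adj G i j ≡ true

degree : ∀ {m} → Graph m → Fin m → ℕ
degree {m} G i = length (filter (λ j → adj G i j Data.Bool.≟ true) (allFin m))

MaxDegreeAtMost : ∀ {m} → Graph m → ℕ → Set
MaxDegreeAtMost {m} G Δ = ∀ (i : Fin m) → degree G i ≤ Δ

Bipartite : ∀ {m} → Graph m → Set
Bipartite {m} G = Σ (Fin m → Bool) λ c → ∀ i j → Edge G i j → c i ≢ c j

-- bandwidth at most b (b a rational, to allow b = β n): there is a labelling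
-- (bijection with Fin m) such that every edge ij has |label i - label j| ≤ b
BandwidthAtMost : ∀ {m} → Graph m → ℚ → Set
BandwidthAtMost {m} G b =
  Σ (Fin m ↔ Fin m) λ σ → ∀ i j → Edge G i j →
    Data.Rational._≤_ (ℕ→ℚ ∣ toℕ (Inverse.to σ i) - toℕ (Inverse.to σ j) ∣) b

InH2 : ∀ {m} → Graph m → ℚ → ℕ → Set
InH2 G b Δ = Bipartite G × MaxDegreeAtMost G Δ × BandwidthAtMost G b

-- an edge-colouring of K_n with colours in ℕ (value on unordered pair {i,j}, i ≠ j)
record EdgeColouring (n : ℕ) : Set where
  field
    col    : Fin n → Fin n → ℕ
    colSym : ∀ i j → col i j ≡ col j i
open EdgeColouring public

edgesK : (n : ℕ) → List (Fin n × Fin n)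
edgesK n = filter (λ p → Data.Product.proj₁ p <? Data.Product.proj₂ p)
                  (concatMap (λ i → map (λ j → (i , j)) (allFin n)) (allFin n))

colourClassSize : ∀ {n} → EdgeColouring n → ℕ → ℕ
colourClassSize {n} φ c =
  length (filter (λ p → col φ (Data.Product.proj₁ p) (Data.Product.proj₂ p) Data.Nat.≟ c) (edgesK n))

KBounded : ∀ {n} → ℕ → EdgeColouring n → Set
KBounded k φ = ∀ (c : ℕ) → colourClassSize φ c ≤ k

PolychromaticCopy : ∀ {m n} → Graph m → EdgeColouring n → (Fin m → Fin n) → Set
PolychromaticCopy {m} H φ f =
  Injective _≡_ _≡_ f ×
  (∀ i j i' j' → Edge H i j → Edge H i' j' →
     col φ (f i) (f j) ≡ col φ (f i') (f j') →
     (i ≡ i' × j ≡ j') ⊎ (i ≡ j' × j ≡ i'))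

HPolychromatic : ∀ {m n} → Graph m → EdgeColouring n → Set
HPolychromatic {m} {n} H φ = ∃[ f ] PolychromaticCopy H φ f

{-# OPTIONS --safe #-}
module Submission where

-- Embed the vertices of H greedily, keeping the list F of all colours ever used on an embedded edge.
-- A vertex of K_n is heavy if a fixed proportion of the edges at it have a colour in F. There are only
-- O(k) heavy vertices, because the classes of the O(n) colours in F contain O(kn) edges. No vertex of H
-- is put on a heavy vertex, and a vertex of H whose image becomes heavy is moved elsewhere. F never
-- shrinks, so a vertex left in this way stays heavy: there are O(k) moves, and a burst of moves raises
-- the number of used colours at a vertex by only O(k²), which is small compared with n as Δ ≥ 2.
-- Two vertices x, x′ must not carry vertices of H with a common neighbour if col x y = col x′ y for a
-- fixed proportion of all y; each x has only O(k) such partners. All this leaves, at each step, fewer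
-- than n forbidden images.

open import Defs renaming (sym to adj-sym)
open import Data.Nat using (ℕ; zero; suc; _+_; _*_; _^_; _≤_; _<_; z≤n; s≤s; s≤s⁻¹)
import Data.Nat as ℕ
open import Data.Nat.Properties hiding (_≟_)
open import Data.Nat.ListAction using (sum)
open import Data.Nat.Logarithm using (⌊log₂_⌋; ⌊log₂⌋-mono-≤)
open import Data.Nat.Tactic.RingSolver using (solve-∀)
open import Data.Bool using (Bool; true; false; if_then_else_; _∨_)
import Data.Bool as Bool
open import Data.Bool.Properties using (¬-not)
open import Data.Fin using (Fin; toℕ; fromℕ<; inject≤)
import Data.Fin as Fin
open import Data.Fin.Properties using (_≟_; any?; toℕ<n; toℕ-fromℕ<; toℕ-injective)
open import Data.Integer using (+[1+_]) renaming (+_ to pos)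
import Data.Integer as ℤ
import Data.Integer.Properties as ℤ
open import Data.List using (List; []; _∷_; _++_; length; map; filter; concatMap; allFin)
open import Data.List.Properties using (length-++; length-map; length-tabulate; length-filter)
open import Data.List.Membership.Propositional using (_∈_)
open import Data.List.Membership.Propositional.Properties using (∈-allFin; ∈-filter⁺; ∈-filter⁻; ∈-map⁺; ∈-++⁺ˡ; ∈-++⁺ʳ)
open import Data.List.Relation.Unary.All using (All; []; _∷_)
open import Data.List.Relation.Unary.AllPairs using ([]; _∷_)
open import Data.List.Relation.Unary.Any using (here; there)
open import Data.List.Relation.Unary.Unique.Propositional using (Unique)
open import Data.List.Relation.Unary.Unique.Propositional.Properties using (allFin⁺)
open import Data.Product using (Σ; _×_; _,_; ∃-syntax; proj₂)
open import Data.Rational using (ℚ; mkℚ; Positive; 1ℚ; toℚᵘ) renaming (_≤_ to _≤ℚ_; _*_ to _*ℚ_; _-_ to _-ℚ_; _+_ to _+ℚ_)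
import Data.Rational as ℚ
import Data.Rational.Properties as ℚ
open import Data.Rational.Solver using (module +-*-Solver)
open import Data.Rational.Unnormalised using (mkℚᵘ; *≡*; *≤*)
import Data.Rational.Unnormalised as ℚᵘ
import Data.Rational.Unnormalised.Properties as ℚᵘ
open import Data.Sum using (_⊎_; inj₁; inj₂)
open import Data.Vec.Functional using (updateAt)
open import Data.Vec.Functional.Properties using (updateAt-updates; updateAt-minimal)
open import Function using (_∘_; const; id)
open import Relation.Binary.Definitions using (DecidableEquality; tri<; tri≈; tri>)
open import Relation.Binary.PropositionalEquality
open import Relation.Nullary using (¬_; Dec; yes; no; does; contradiction; ¬?; _×-dec_)
open import Relation.Nullary.Decidable using (decidable-stable)
open import Relation.Unary using (Decidable)

-- Finite sums

ind : ∀ {p} {P : Set p} → Dec P → ℕ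
ind d = if does d then 1 else 0

ind-≤ : ∀ {p} {P : Set p} (d : Dec P) {b} → (P → 1 ≤ b) → ind d ≤ b
ind-≤ (yes x) 1≤b = 1≤b x
ind-≤ (no _)  _   = z≤n

ind-yes : ∀ {p} {P : Set p} (d : Dec P) → P → ind d ≡ 1
ind-yes (yes _) _ = refl
ind-yes (no ¬x) x = contradiction x ¬x

ind-mono : ∀ {p q} {P : Set p} {Q : Set q} → (P → Q) → (d : Dec P) (e : Dec Q) → ind d ≤ ind e
ind-mono f d e = ind-≤ d (λ x → ≤-reflexive (sym (ind-yes e (f x))))

ind-no : ∀ {p} {P : Set p} (d : Dec P) → ¬ P → ind d ≡ 0
ind-no (yes x) ¬x = contradiction x ¬x
ind-no (no _)  _  = refl

ind≡0⇒¬ : ∀ {p} {P : Set p} (d : Dec P) → ind d ≡ 0 → ¬ P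
ind≡0⇒¬ (no ¬x) _ = ¬x

ind≤1 : ∀ {p} {P : Set p} (d : Dec P) → ind d ≤ 1
ind≤1 (yes _) = ≤-refl
ind≤1 (no _)  = z≤n

module _ {A : Set} where

  ∑ : List A → (A → ℕ) → ℕ
  ∑ xs f = sum (map f xs)

  ∑-mono : ∀ xs {f g : A → ℕ} → (∀ x → f x ≤ g x) → ∑ xs f ≤ ∑ xs g
  ∑-mono []       f≤g = z≤n
  ∑-mono (x ∷ xs) f≤g = +-mono-≤ (f≤g x) (∑-mono xs f≤g)

  ∑-cong : ∀ xs {f g : A → ℕ} → (∀ x → f x ≡ g x) → ∑ xs f ≡ ∑ xs g
  ∑-cong xs f≡g = ≤-antisym (∑-mono xs (≤-reflexive ∘ f≡g)) (∑-mono xs (≤-reflexive ∘ sym ∘ f≡g))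

  ∑-mono-< : ∀ {xs} {f g : A → ℕ} → (∀ x → f x ≤ g x) →
             ∀ {x} → x ∈ xs → f x < g x → ∑ xs f < ∑ xs g
  ∑-mono-< {_ ∷ xs} f≤g (here refl) f<g = +-mono-<-≤ f<g (∑-mono xs f≤g)
  ∑-mono-< {y ∷ _}  f≤g (there x∈)  f<g = +-mono-≤-< (f≤g y) (∑-mono-< f≤g x∈ f<g)

  ∑-bound : ∀ xs {f : A → ℕ} {b} → (∀ {x} → x ∈ xs → f x ≤ b) → ∑ xs f ≤ length xs * b
  ∑-bound []       f≤b = z≤n
  ∑-bound (x ∷ xs) f≤b = +-mono-≤ (f≤b (here refl)) (∑-bound xs (f≤b ∘ there))

  ∑-zero : ∀ (xs : List A) → ∑ xs (λ _ → 0) ≡ 0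
  ∑-zero []       = refl
  ∑-zero (x ∷ xs) = ∑-zero xs

  ∑-+ : ∀ xs (f g : A → ℕ) → ∑ xs (λ x → f x + g x) ≡ ∑ xs f + ∑ xs g
  ∑-+ []       f g = refl
  ∑-+ (x ∷ xs) f g rewrite ∑-+ xs f g = lemma (f x) (g x) (∑ xs f) (∑ xs g)
    where
    lemma : ∀ a b c d → (a + b) + (c + d) ≡ (a + c) + (b + d)
    lemma = solve-∀

  ∑-* : ∀ c xs (f : A → ℕ) → ∑ xs (λ x → c * f x) ≡ c * ∑ xs f
  ∑-* c []       f = sym (*-zeroʳ c)
  ∑-* c (x ∷ xs) f rewrite ∑-* c xs f = sym (*-distribˡ-+ c (f x) (∑ xs f))

  ∑-++ : ∀ xs ys (f : A → ℕ) → ∑ (xs ++ ys) f ≡ ∑ xs f + ∑ ys f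
  ∑-++ []       ys f = refl
  ∑-++ (x ∷ xs) ys f rewrite ∑-++ xs ys f = sym (+-assoc (f x) _ _)

  term≤∑ : ∀ {xs} (f : A → ℕ) {x} → x ∈ xs → f x ≤ ∑ xs f
  term≤∑ f (here refl) = m≤m+n _ _
  term≤∑ f (there x∈)  = ≤-trans (term≤∑ f x∈) (m≤n+m _ _)

  ∑≡0⇒term≡0 : ∀ {xs} (f : A → ℕ) → ∑ xs f ≡ 0 → ∀ {x} → x ∈ xs → f x ≡ 0
  ∑≡0⇒term≡0 f eq x∈ = n≤0⇒n≡0 (≤-trans (term≤∑ f x∈) (≤-reflexive eq))

  -- Pigeonhole for weights. With `f` counting the reasons against an image, it yields an image
  -- against which there is none.
  vanishing-term : ∀ xs (f : A → ℕ) → ∑ xs f < length xs → ∃[ x ] f x ≡ 0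
  vanishing-term (x ∷ xs) f lt with f x in eq
  ... | zero  = x , eq
  ... | suc c = vanishing-term xs f (≤-trans (s≤s (m≤n+m _ c)) (s≤s⁻¹ lt))

  length-filter-∑ : ∀ {P : A → Set} (P? : Decidable P) xs →
                    length (filter P? xs) ≡ ∑ xs (ind ∘ P?)
  length-filter-∑ P? []       = refl
  length-filter-∑ P? (x ∷ xs) with P? x
  ... | yes _ = cong suc (length-filter-∑ P? xs)
  ... | no _  = length-filter-∑ P? xs

  ∑-filter : ∀ {P : A → Set} (P? : Decidable P) xs (f : A → ℕ) →
             ∑ (filter P? xs) f ≡ ∑ xs (λ x → ind (P? x) * f x)
  ∑-filter P? []       f = refl
  ∑-filter P? (x ∷ xs) f with P? x
  ... | yes _ = cong₂ _+_ (sym (*-identityˡ (f x))) (∑-filter P? xs f)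
  ... | no _  = ∑-filter P? xs f

  count-≡ : (_≟_ : DecidableEquality A) → ∀ {xs} → Unique xs →
            ∀ z → ∑ xs (λ x → ind (z ≟ x)) ≤ 1
  count-≡ _≟_ []         z = z≤n
  count-≡ _≟_ {x ∷ xs} (x∉xs ∷ uniq) z with z ≟ x
  ... | no _     = count-≡ _≟_ uniq z
  ... | yes refl = s≤s (≤-reflexive (absent x∉xs))
    where
    absent : ∀ {ys} → All (z ≢_) ys → ∑ ys (λ y → ind (z ≟ y)) ≡ 0
    absent []         = refl
    absent (z≢y ∷ ps) = cong₂ _+_ (ind-no (z ≟ _) z≢y) (absent ps)

  -- Each `x` with `t < f x` contributes at least `t` to the right-hand sum.
  markov : ∀ t xs (f : A → ℕ) → t * ∑ xs (λ x → ind (t ℕ.<? f x)) ≤ ∑ xs f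
  markov t xs f = ≤-trans (≤-reflexive (sym (∑-* t xs _))) (∑-mono xs (λ x → scaled (t ℕ.<? f x)))
    where
    scaled : ∀ {y} (d : Dec (t < y)) → t * ind d ≤ y
    scaled (yes t<y) = ≤-trans (≤-reflexive (*-identityʳ t)) (<⇒≤ t<y)
    scaled (no _)    = ≤-trans (≤-reflexive (*-zeroʳ t)) z≤n

module _ {A B : Set} where

  ∑-map : ∀ (g : A → B) xs (f : B → ℕ) → ∑ (map g xs) f ≡ ∑ xs (f ∘ g)
  ∑-map g []       f = refl
  ∑-map g (x ∷ xs) f = cong (f (g x) +_) (∑-map g xs f)

  ∑-concatMap : ∀ (g : A → List B) xs (f : B → ℕ) →
                ∑ (concatMap g xs) f ≡ ∑ xs (λ x → ∑ (g x) f)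
  ∑-concatMap g []       f = refl
  ∑-concatMap g (x ∷ xs) f =
    trans (∑-++ (g x) _ f) (cong (∑ (g x) f +_) (∑-concatMap g xs f))

  ∑-swap : ∀ xs ys (f : A → B → ℕ) →
           ∑ xs (λ x → ∑ ys (f x)) ≡ ∑ ys (λ y → ∑ xs (λ x → f x y))
  ∑-swap []       ys f = sym (∑-zero ys)
  ∑-swap (x ∷ xs) ys f =
    trans (cong (∑ ys (f x) +_) (∑-swap xs ys f)) (sym (∑-+ ys (f x) _))

-- Clearing denominators in the hypotheses

-- `ℕ→ℚ` normalises by a gcd, which does not compute on a variable. Among unnormalised rationals the
-- denominator is plainly one, so the arithmetic of `ℕ→ℚ` is transferred from there.
toℚᵘ-ℕ→ℚ : ∀ n → toℚᵘ (ℕ→ℚ n) ℚᵘ.≃ mkℚᵘ (pos n) 0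
toℚᵘ-ℕ→ℚ n = ℚ.toℚᵘ-fromℚᵘ (mkℚᵘ (pos n) 0)

ℕ→ℚ-+ : ∀ a b → ℕ→ℚ (a + b) ≡ ℕ→ℚ a +ℚ ℕ→ℚ b
ℕ→ℚ-+ a b = ℚ.toℚᵘ-injective (begin
  toℚᵘ (ℕ→ℚ (a + b))                ≈⟨ toℚᵘ-ℕ→ℚ (a + b) ⟩
  mkℚᵘ (pos (a + b)) 0                 ≈⟨ *≡* (cong (ℤ._* pos 1) (sym (cong₂ ℤ._+_ (ℤ.*-identityʳ (pos a)) (ℤ.*-identityʳ (pos b))))) ⟩
  mkℚᵘ (pos a) 0 ℚᵘ.+ mkℚᵘ (pos b) 0     ≈⟨ ℚᵘ.+-cong (toℚᵘ-ℕ→ℚ a) (toℚᵘ-ℕ→ℚ b) ⟨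
  toℚᵘ (ℕ→ℚ a) ℚᵘ.+ toℚᵘ (ℕ→ℚ b)     ≈⟨ ℚ.toℚᵘ-homo-+ (ℕ→ℚ a) (ℕ→ℚ b) ⟨
  toℚᵘ (ℕ→ℚ a +ℚ ℕ→ℚ b)              ∎)
  where open import Relation.Binary.Reasoning.Setoid ℚᵘ.≃-setoid

ℕ→ℚ-* : ∀ a b → ℕ→ℚ (a * b) ≡ ℕ→ℚ a *ℚ ℕ→ℚ b
ℕ→ℚ-* a b = ℚ.toℚᵘ-injective (begin
  toℚᵘ (ℕ→ℚ (a * b))                ≈⟨ toℚᵘ-ℕ→ℚ (a * b) ⟩
  mkℚᵘ (pos (a * b)) 0                 ≈⟨ *≡* (cong (ℤ._* (pos 1)) (ℤ.pos-* a b)) ⟩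
  mkℚᵘ (pos a) 0 ℚᵘ.* mkℚᵘ (pos b) 0     ≈⟨ ℚᵘ.*-cong (toℚᵘ-ℕ→ℚ a) (toℚᵘ-ℕ→ℚ b) ⟨
  toℚᵘ (ℕ→ℚ a) ℚᵘ.* toℚᵘ (ℕ→ℚ b)     ≈⟨ ℚ.toℚᵘ-homo-* (ℕ→ℚ a) (ℕ→ℚ b) ⟨
  toℚᵘ (ℕ→ℚ a *ℚ ℕ→ℚ b)              ∎)
  where open import Relation.Binary.Reasoning.Setoid ℚᵘ.≃-setoid

ℕ→ℚ-cancel-≤ : ∀ {a b} → ℕ→ℚ a ≤ℚ ℕ→ℚ b → a ≤ b
ℕ→ℚ-cancel-≤ {a} {b} a≤b = ℤ.drop‿+≤+ (subst₂ ℤ._≤_ (ℤ.*-identityʳ (pos a)) (ℤ.*-identityʳ (pos b))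
  (ℚᵘ.drop-*≤* (ℚᵘ.≤-respˡ-≃ (toℚᵘ-ℕ→ℚ a) (ℚᵘ.≤-respʳ-≃ (toℚᵘ-ℕ→ℚ b) (ℚ.toℚᵘ-mono-≤ a≤b)))))

ℕ→ℚ-mono-≤ : ∀ {a b} → a ≤ b → ℕ→ℚ a ≤ℚ ℕ→ℚ b
ℕ→ℚ-mono-≤ {a} {b} a≤b = ℚ.toℚᵘ-cancel-≤ (ℚᵘ.≤-respˡ-≃ (ℚᵘ.≃-sym (toℚᵘ-ℕ→ℚ a))
  (ℚᵘ.≤-respʳ-≃ (ℚᵘ.≃-sym (toℚᵘ-ℕ→ℚ b))
    (*≤* (subst₂ ℤ._≤_ (sym (ℤ.*-identityʳ (pos a))) (sym (ℤ.*-identityʳ (pos b))) (ℤ.+≤+ a≤b)))))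

ℕ→ℚ-nonNeg : ∀ n → ℚ.NonNegative (ℕ→ℚ n)
ℕ→ℚ-nonNeg n = ℚ.nonNegative (ℕ→ℚ-mono-≤ {0} {n} z≤n)

ℕ→ℚ-pos : ∀ n → Positive (ℕ→ℚ (suc n))
ℕ→ℚ-pos n = ℚ.normalize-pos (suc n) 1

-- The witnesses are the denominator and the numerator of `η`, each less one.
clear-denominator : ∀ η → Positive η → ∃[ e ] ∃[ c ] ℕ→ℚ (suc e) *ℚ η ≡ ℕ→ℚ (suc c)
clear-denominator η@(mkℚ +[1+ c ] e _) _ = e , c , ℚ.toℚᵘ-injective (begin
  toℚᵘ (ℕ→ℚ (suc e) *ℚ η)                    ≈⟨ ℚ.toℚᵘ-homo-* (ℕ→ℚ (suc e)) η ⟩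
  toℚᵘ (ℕ→ℚ (suc e)) ℚᵘ.* mkℚᵘ +[1+ c ] e     ≈⟨ ℚᵘ.*-congʳ (toℚᵘ-ℕ→ℚ (suc e)) ⟩
  mkℚᵘ (pos (suc e)) 0 ℚᵘ.* mkℚᵘ +[1+ c ] e        ≈⟨ *≡* (trans (ℤ.*-identityʳ _) (trans (ℤ.*-comm (pos (suc e)) +[1+ c ]) (cong (λ d → +[1+ c ] ℤ.* pos d) (sym (*-identityˡ (suc e)))))) ⟩
  mkℚᵘ (pos (suc c)) 0                             ≈⟨ toℚᵘ-ℕ→ℚ (suc c) ⟨
  toℚᵘ (ℕ→ℚ (suc c))                          ∎)
  where open import Relation.Binary.Reasoning.Setoid ℚᵘ.≃-setoid

-- Multiplying the hypothesis by `e` leaves `e η n = suc c * n` spare on the right, which is at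
-- least `n`.
spare-vertices : ∀ {η e c} → ℕ→ℚ e *ℚ η ≡ ℕ→ℚ (suc c) → ∀ m n →
                 ℕ→ℚ m ≤ℚ (1ℚ -ℚ η) *ℚ ℕ→ℚ n → e * m + n ≤ e * n
spare-vertices {η} {e} {c} eη≡c m n m≤ = ≤-trans (+-monoʳ-≤ (e * m) (m≤m+n n (c * n)))
  (ℕ→ℚ-cancel-≤ (begin
    ℕ→ℚ (e * m + suc c * n)                                    ≡⟨ ℕ→ℚ-+ (e * m) (suc c * n) ⟩
    ℕ→ℚ (e * m) +ℚ ℕ→ℚ (suc c * n)                              ≡⟨ cong₂ _+ℚ_ (ℕ→ℚ-* e m) (trans (ℕ→ℚ-* (suc c) n) (cong (_*ℚ N) (sym eη≡c))) ⟩
    E *ℚ ℕ→ℚ m +ℚ E *ℚ η *ℚ N                                   ≤⟨ ℚ.+-monoˡ-≤ (E *ℚ η *ℚ N) (ℚ.*-monoˡ-≤-nonNeg E {{ℕ→ℚ-nonNeg e}} m≤) ⟩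
    E *ℚ ((1ℚ -ℚ η) *ℚ N) +ℚ E *ℚ η *ℚ N                        ≡⟨ solve 3 (λ E η N → E :* ((con 1ℚ :- η) :* N) :+ E :* η :* N := E :* N) refl E η N ⟩
    E *ℚ N                                                      ≡⟨ ℕ→ℚ-* e n ⟨
    ℕ→ℚ (e * n)                                                ∎))
  where
  open ℚ.≤-Reasoning
  open +-*-Solver
  E = ℕ→ℚ e
  N = ℕ→ℚ n

clear-powers : ∀ {κ} K → ℕ→ℚ K *ℚ κ ≡ 1ℚ → ∀ Δ → ℕ→ℚ (K ^ Δ) *ℚ (κ ^ℚ Δ) ≡ 1ℚ
clear-powers K Kκ zero = refl
clear-powers {κ} K Kκ (suc Δ) = begin
  ℕ→ℚ (K * K ^ Δ) *ℚ (κ *ℚ (κ ^ℚ Δ))            ≡⟨ cong (_*ℚ _) (ℕ→ℚ-* K (K ^ Δ)) ⟩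
  (ℕ→ℚ K *ℚ ℕ→ℚ (K ^ Δ)) *ℚ (κ *ℚ (κ ^ℚ Δ))     ≡⟨ solve 4 (λ a b c d → (a :* b) :* (c :* d) := (a :* c) :* (b :* d)) refl (ℕ→ℚ K) (ℕ→ℚ (K ^ Δ)) κ (κ ^ℚ Δ) ⟩
  (ℕ→ℚ K *ℚ κ) *ℚ (ℕ→ℚ (K ^ Δ) *ℚ (κ ^ℚ Δ))     ≡⟨ cong₂ _*ℚ_ Kκ (clear-powers K Kκ Δ) ⟩
  1ℚ *ℚ 1ℚ                                       ≡⟨⟩
  1ℚ                                             ∎
  where
  open ≡-Reasoning
  open +-*-Solver

^-distribʳ-* : ∀ a b d → (a * b) ^ d ≡ a ^ d * b ^ d
^-distribʳ-* a b zero = refl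
^-distribʳ-* a b (suc d) rewrite ^-distribʳ-* a b d = interchange a b (a ^ d) (b ^ d)
  where
  interchange : ∀ a b c d → a * b * (c * d) ≡ a * c * (b * d)
  interchange = solve-∀

square≤pow : ∀ {x d} → 2 ≤ d → x * x ≤ x ^ d
square≤pow {zero}  _   = z≤n
square≤pow {suc x} 2≤d = ≤-trans (≤-reflexive (cong (suc x *_) (sym (*-identityʳ (suc x))))) (^-monoʳ-≤ (suc x) 2≤d)

-- As `2 ≤ Δ`, the square is at most `K ^ Δ * k ^ Δ`. The logarithm is at least one and may be
-- inserted as a factor; then `K ^ Δ` cancels the power of `κ`.
square-bound : ∀ {κ K Δ} → ℕ→ℚ K *ℚ κ ≡ 1ℚ → 2 ≤ Δ → ∀ {n} → 2 ≤ n → ∀ k →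
               ℕ→ℚ (k ^ Δ * ⌊log₂ n ⌋) ≤ℚ (κ ^ℚ Δ) *ℚ ℕ→ℚ n → (K * k) * (K * k) ≤ n
square-bound {κ} {K} {Δ} Kκ 2≤Δ {n} 2≤n k k≤ = begin
  (K * k) * (K * k)               ≤⟨ square≤pow 2≤Δ ⟩
  (K * k) ^ Δ                     ≡⟨ ^-distribʳ-* K k Δ ⟩
  K ^ Δ * k ^ Δ                   ≡⟨ cong (K ^ Δ *_) (*-identityʳ (k ^ Δ)) ⟨
  K ^ Δ * (k ^ Δ * 1)             ≤⟨ *-monoʳ-≤ (K ^ Δ) (*-monoʳ-≤ (k ^ Δ) (⌊log₂⌋-mono-≤ 2≤n)) ⟩
  K ^ Δ * (k ^ Δ * ⌊log₂ n ⌋)     ≤⟨ ℕ→ℚ-cancel-≤ cleared ⟩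
  n                               ∎
  where
  open ≤-Reasoning
  cleared : ℕ→ℚ (K ^ Δ * (k ^ Δ * ⌊log₂ n ⌋)) ≤ℚ ℕ→ℚ n
  cleared = ℚ.≤-trans (ℚ.≤-reflexive (ℕ→ℚ-* (K ^ Δ) _))
    (ℚ.≤-trans (ℚ.*-monoˡ-≤-nonNeg (ℕ→ℚ (K ^ Δ)) {{ℕ→ℚ-nonNeg (K ^ Δ)}} k≤)
    (ℚ.≤-reflexive (trans (sym (ℚ.*-assoc (ℕ→ℚ (K ^ Δ)) (κ ^ℚ Δ) (ℕ→ℚ n)))
      (trans (cong (_*ℚ ℕ→ℚ n) (clear-powers K Kκ Δ)) (ℚ.*-identityˡ (ℕ→ℚ n))))))

-- Colour degrees and codegrees

length-allFin : ∀ n → length (allFin n) ≡ n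
length-allFin n = length-tabulate id

module Colouring {n} (φ : EdgeColouring n) where

  -- `col` has values on the diagonal too, where there is no edge; `x ≢ y` excludes them.
  at? : ∀ c x y → Dec (x ≢ y × col φ x y ≡ c)
  at? c x y = ¬? (x ≟ y) ×-dec (col φ x y ℕ.≟ c)

  -- The condition `x ≢ x′` makes the codegree of a vertex with itself zero, so that later sums and
  -- bounds may range over all pairs of neighbours, equal ones included.
  clash? : ∀ x x′ y → Dec (x ≢ x′ × x ≢ y × x′ ≢ y × col φ x y ≡ col φ x′ y)
  clash? x x′ y = ¬? (x ≟ x′) ×-dec ¬? (x ≟ y) ×-dec ¬? (x′ ≟ y) ×-dec (col φ x y ℕ.≟ col φ x′ y)

  colourDegree : ℕ → Fin n → ℕ
  colourDegree c x = ∑ (allFin n) (λ y → ind (at? c x y))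

  load : List ℕ → Fin n → ℕ
  load F x = ∑ F (λ c → colourDegree c x)

  codegree : Fin n → Fin n → ℕ
  codegree x x′ = ∑ (allFin n) (λ y → ind (clash? x x′ y))

  codegree-sym : ∀ x x′ → codegree x x′ ≤ codegree x′ x
  codegree-sym x x′ = ∑-mono (allFin n) λ y →
    ind-mono (λ (x≢x′ , x≢y , x′≢y , eq) → x≢x′ ∘ sym , x′≢y , x≢y , sym eq)
      (clash? x x′ y) (clash? x′ x y)

  codegree-diag : ∀ x → codegree x x ≡ 0
  codegree-diag x = n≤0⇒n≡0 (≤-trans
    (∑-mono (allFin n) (λ y → ≤-reflexive (ind-no (clash? x x y) (λ (x≢x , _) → x≢x refl))))
    (≤-reflexive (∑-zero (allFin n))))

  load-mono : ∀ F {G} x → load G x ≤ load (F ++ G) x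
  load-mono F x = ≤-trans (m≤n+m _ _) (≤-reflexive (sym (∑-++ F _ _)))

  -- Each edge is counted at both its ends, while `edgesK` lists it once, smaller end first.
  handshake : ∀ {k} → KBounded k φ → ∀ c → ∑ (allFin n) (colourDegree c) ≤ 2 * k
  handshake {k} bounded c = begin
    ∑ V (λ x → ∑ V (λ y → ind (at? c x y)))                   ≤⟨ ∑-mono V (λ x → ∑-mono V (oriented x)) ⟩
    ∑ V (λ x → ∑ V (λ y → below x y + below y x))             ≤⟨ ∑-mono V (λ x → ≤-reflexive (∑-+ V (below x) _)) ⟩
    ∑ V (λ x → ∑ V (below x) + ∑ V (λ y → below y x))         ≡⟨ ∑-+ V _ _ ⟩
    ∑ V (λ x → ∑ V (below x)) + ∑ V (λ x → ∑ V (λ y → below y x)) ≡⟨ cong (∑ V (λ x → ∑ V (below x)) +_) (∑-swap V V below) ⟨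
    S + S                                                     ≡⟨ cong (S +_) (+-identityʳ S) ⟨
    2 * S                                                     ≡⟨ cong (2 *_) classSize ⟨
    2 * colourClassSize φ c                                   ≤⟨ *-monoʳ-≤ 2 (bounded c) ⟩
    2 * k                                                     ∎
    where
    open ≤-Reasoning
    V = allFin n
    below : Fin n → Fin n → ℕ
    below x y = ind (x Fin.<? y) * ind (col φ x y ℕ.≟ c)
    S = ∑ V (λ x → ∑ V (below x))

    oriented : ∀ x y → ind (at? c x y) ≤ below x y + below y x
    oriented x y = ind-≤ (at? c x y) ordered
      where
      ordered : x ≢ y × col φ x y ≡ c → 1 ≤ below x y + below y x
      ordered (x≢y , xy≡c) with <-cmp (toℕ x) (toℕ y)
      ... | tri< x<y _ _ rewrite ind-yes (x Fin.<? y) x<y | ind-yes (col φ x y ℕ.≟ c) xy≡c = s≤s z≤n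
      ... | tri≈ _ x≡y _ = contradiction (toℕ-injective x≡y) x≢y
      ... | tri> _ _ y<x rewrite ind-yes (y Fin.<? x) y<x | ind-yes (col φ y x ℕ.≟ c) (trans (colSym φ y x) xy≡c) = m≤n+m 1 _

    classSize : colourClassSize φ c ≡ S
    classSize = begin-equality
      colourClassSize φ c
        ≡⟨ length-filter-∑ _ (edgesK n) ⟩
      ∑ (edgesK n) (λ (x , y) → ind (col φ x y ℕ.≟ c))
        ≡⟨ ∑-filter _ (concatMap (λ i → map (i ,_) V) V) _ ⟩
      ∑ (concatMap (λ i → map (i ,_) V) V) (λ (x , y) → below x y)
        ≡⟨ ∑-concatMap (λ i → map (i ,_) V) V _ ⟩
      ∑ V (λ x → ∑ (map (x ,_) V) (λ (x , y) → below x y))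
        ≡⟨ ∑-cong V (λ x → ∑-map (x ,_) V _) ⟩
      S ∎

  module _ {D} (class≤D : ∀ c → ∑ (allFin n) (colourDegree c) ≤ D) where

    colourDegree≤ : ∀ c x → colourDegree c x ≤ D
    colourDegree≤ c x = ≤-trans (term≤∑ (colourDegree c) (∈-allFin x)) (class≤D c)

    load≤ : ∀ F x → load F x ≤ length F * D
    load≤ F x = ∑-bound F (λ {c} _ → colourDegree≤ c x)

    ∑-load : ∀ F → ∑ (allFin n) (load F) ≤ length F * D
    ∑-load F = ≤-trans (≤-reflexive (∑-swap (allFin n) F _)) (∑-bound F (λ {c} _ → class≤D c))

    -- For fixed `y`, every `x′` that clashes with `x` is joined to `y` in the colour of `x y`, and
    -- at most `D` edges at `y` have that colour.
    ∑-codegree : ∀ x → ∑ (allFin n) (codegree x) ≤ n * D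
    ∑-codegree x = begin
      ∑ V (λ x′ → ∑ V (λ y → ind (clash? x x′ y)))     ≡⟨ ∑-swap V V _ ⟩
      ∑ V (λ y → ∑ V (λ x′ → ind (clash? x x′ y)))     ≤⟨ ∑-mono V (λ y → ∑-mono V (λ x′ → ind-mono
          (λ (_ , _ , x′≢y , eq) → x′≢y ∘ sym , trans (colSym φ y x′) (sym eq)) (clash? x x′ y) (at? (col φ x y) y x′))) ⟩
      ∑ V (λ y → colourDegree (col φ x y) y)           ≤⟨ ∑-bound V (λ {y} _ → colourDegree≤ (col φ x y) y) ⟩
      length V * D                                     ≡⟨ cong (_* D) (length-allFin n) ⟩
      n * D                                            ∎
      where
      open ≤-Reasoning
      V = allFin n

-- The greedy embedding with moves

module Embedding
  {m n} (H : Graph m) (φ : EdgeColouring n) (Δ A D : ℕ)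
  (deg≤Δ : MaxDegreeAtMost H Δ)
  (class≤D : ∀ c → ∑ (allFin n) (Colouring.colourDegree φ c) ≤ D)
  where

  open Colouring φ

  -- The most that a single placement can add to `A * load F x`: it brings at most `Δ` new colours,
  -- each of degree at most `D` at `x`.
  E : ℕ
  E = A * (Δ * D)

  Placed : ℕ → Fin m → Set
  Placed p i = toℕ i < p

  Heavy : List ℕ → Fin n → Set
  Heavy F x = n < A * load F x

  nbrs : Fin m → List (Fin m)
  nbrs u = filter (λ j → adj H u j Bool.≟ true) (allFin m)

  placedNbrs : ℕ → Fin m → List (Fin m)
  placedNbrs p u = filter (λ i → toℕ i ℕ.<? p) (nbrs u)

  ∈-nbrs : ∀ {u i} → Edge H u i → i ∈ nbrs u
  ∈-nbrs e = ∈-filter⁺ (λ j → adj H _ j Bool.≟ true) (∈-allFin _) e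

  ∈-placedNbrs : ∀ {p u i} → Edge H u i → Placed p i → i ∈ placedNbrs p u
  ∈-placedNbrs e i<p = ∈-filter⁺ (λ i → toℕ i ℕ.<? _) (∈-nbrs e) i<p

  placedNbrs⁻ : ∀ {p u i} → i ∈ placedNbrs p u → Edge H u i × Placed p i
  placedNbrs⁻ {p} {u} i∈ with ∈-filter⁻ (λ i → toℕ i ℕ.<? p) {xs = nbrs u} i∈
  ... | i∈nbrs , i<p = proj₂ (∈-filter⁻ (λ j → adj H u j Bool.≟ true) {xs = allFin m} i∈nbrs) , i<p

  length-placedNbrs : ∀ p u → length (placedNbrs p u) ≤ Δ
  length-placedNbrs p u = ≤-trans (length-filter _ (nbrs u)) (deg≤Δ u)

  edge-sym : ∀ {i j} → Edge H i j → Edge H j i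
  edge-sym {i} {j} e = trans (adj-sym H j i) e

  no-loop : ∀ {i} → ¬ Edge H i i
  no-loop {i} e with trans (sym e) (irrefl H i)
  ... | ()

  -- The first `p` vertices of `H` are placed; `f` is total, but its other values are not
  -- constrained. `F` may also hold colours of edges that a move has since undone. In `sparse` the
  -- common neighbour `v` need not be placed: the bound is kept ready for when `v` gets an image.
  record Partial (p : ℕ) (F : List ℕ) (f : Fin m → Fin n) : Set where
    field
      inj      : ∀ {i j} → Placed p i → Placed p j → f i ≡ f j → i ≡ j
      recorded : ∀ {i j} → Placed p i → Placed p j → Edge H i j → col φ (f i) (f j) ∈ F
      rainbow  : ∀ {i j i′ j′} → Placed p i → Placed p j → Placed p i′ → Placed p j′ →
                 Edge H i j → Edge H i′ j′ → col φ (f i) (f j) ≡ col φ (f i′) (f j′) →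
                 (i ≡ i′ × j ≡ j′) ⊎ (i ≡ j′ × j ≡ i′)
      sparse   : ∀ {v i j} → Edge H v i → Edge H v j → Placed p i → Placed p j →
                 A * codegree (f i) (f j) ≤ n

  record Admissible (p : ℕ) (F : List ℕ) (f : Fin m → Fin n) (u : Fin m) (y : Fin n) : Set where
    field
      unused    : ∀ i → f i ≢ y
      light     : ¬ Heavy F y
      newColour : ∀ {i} → Edge H u i → Placed p i → ¬ col φ (f i) y ∈ F
      distinct  : ∀ {i j} → Edge H u i → Edge H u j → Placed p i → Placed p j →
                  col φ (f i) y ≡ col φ (f j) y → f i ≡ f j
      compatible : ∀ {v j} → Edge H u v → Edge H v j → Placed p j → A * codegree (f j) y ≤ n

  newColours : ℕ → (Fin m → Fin n) → Fin m → Fin n → List ℕ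
  newColours p f u y = map (λ i → col φ (f i) y) (placedNbrs p u)

  place : (Fin m → Fin n) → Fin m → Fin n → Fin m → Fin n
  place f u y = updateAt f u (const y)

  placeView : ∀ {p p′ f u y} → (∀ i → Placed p′ i → i ≡ u ⊎ Placed p i) → ∀ {i} → Placed p′ i →
              (i ≡ u × place f u y i ≡ y) ⊎ (i ≢ u × Placed p i × place f u y i ≡ f i)
  placeView {f = f} {u} grow {i} i<p′ with i ≟ u | grow i i<p′
  ... | yes refl | _        = inj₁ (refl , updateAt-updates u f)
  ... | no i≢u   | inj₁ i≡u = contradiction i≡u i≢u
  ... | no i≢u   | inj₂ i<p = inj₂ (i≢u , i<p , updateAt-minimal i u f i≢u)

  -- The first hypothesis holds for the addition of the next vertex, where `p′` is `suc p`, and for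
  -- a move, where `p′` is `p`; both kinds of step share this proof.
  extend : ∀ {p p′ F f u y} → (∀ i → Placed p′ i → i ≡ u ⊎ Placed p i) →
           Partial p F f → Admissible p F f u y →
           Partial p′ (newColours p f u y ++ F) (place f u y)
  extend {p} {p′} {F} {f} {u} {y} grow partl adm = record
    { inj = inj′ ; recorded = recorded′ ; rainbow = rainbow′ ; sparse = sparse′ }
    where
    open Partial partl
    open Admissible adm
    view : ∀ {i} → Placed p′ i → _
    view = placeView {p} {p′} {f} {u} {y} grow

    inj′ : ∀ {i j} → Placed p′ i → Placed p′ j → place f u y i ≡ place f u y j → i ≡ j
    inj′ i< j< eq with view i< | view j<
    ... | inj₁ (refl , _)  | inj₁ (refl , _)  = refl
    ... | inj₁ (refl , ei) | inj₂ (_ , _ , ej) = contradiction (trans (sym ej) (trans (sym eq) ei)) (unused _)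
    ... | inj₂ (_ , _ , ei) | inj₁ (refl , ej) = contradiction (trans (sym ei) (trans eq ej)) (unused _)
    ... | inj₂ (_ , pi , ei) | inj₂ (_ , pj , ej) = inj pi pj (trans (sym ei) (trans eq ej))

    recordedNew : ∀ {i} → Edge H u i → Placed p i → col φ (f i) y ∈ newColours p f u y ++ F
    recordedNew e pi = ∈-++⁺ˡ (∈-map⁺ (λ i → col φ (f i) y) (∈-placedNbrs e pi))

    recorded′ : ∀ {i j} → Placed p′ i → Placed p′ j → Edge H i j →
                col φ (place f u y i) (place f u y j) ∈ newColours p f u y ++ F
    recorded′ i< j< e with view i< | view j<
    ... | inj₁ (refl , _)   | inj₁ (refl , _) = contradiction e no-loop
    ... | inj₁ (refl , ei)  | inj₂ (_ , pj , ej) rewrite ei | ej =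
          subst (_∈ newColours p f u y ++ F) (colSym φ _ _) (recordedNew e pj)
    ... | inj₂ (_ , pi , ei) | inj₁ (refl , ej) rewrite ei | ej = recordedNew (edge-sym e) pi
    ... | inj₂ (_ , pi , ei) | inj₂ (_ , pj , ej) rewrite ei | ej = ∈-++⁺ʳ (newColours p f u y) (recorded pi pj e)

    oldNew : ∀ {i j j′} → Placed p i → Placed p j → Placed p j′ → Edge H i j → Edge H u j′ →
             col φ (f j′) y ≢ col φ (f i) (f j)
    oldNew pi pj pj′ e e′ eq = newColour e′ pj′ (subst (_∈ F) (sym eq) (recorded pi pj e))

    newNew : ∀ {j j′} → Placed p j → Placed p j′ → Edge H u j → Edge H u j′ →
             col φ (f j) y ≡ col φ (f j′) y → j ≡ j′
    newNew pj pj′ e e′ eq = inj pj pj′ (distinct e e′ pj pj′ eq)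

    swap : ∀ {x z} → col φ x z ≡ col φ z x
    swap = colSym φ _ _

    rainbow′ : ∀ {i j i′ j′} → Placed p′ i → Placed p′ j → Placed p′ i′ → Placed p′ j′ →
               Edge H i j → Edge H i′ j′ →
               col φ (place f u y i) (place f u y j) ≡ col φ (place f u y i′) (place f u y j′) →
               (i ≡ i′ × j ≡ j′) ⊎ (i ≡ j′ × j ≡ i′)
    -- The cases differ in which ends are `u`. Two edges at `u` are told apart by `newNew`, an edge
    -- at `u` and an old edge by `oldNew`, two old edges by `rainbow`; an edge with both ends `u`
    -- would be a loop.
    rainbow′ i< j< i′< j′< e e′ eq with view i< | view j< | view i′< | view j′<
    ... | inj₁ (refl , _) | inj₁ (refl , _) | _ | _ = contradiction e no-loop
    ... | inj₁ _ | inj₂ _ | inj₁ (refl , _) | inj₁ (refl , _) = contradiction e′ no-loop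
    ... | inj₂ _ | inj₁ _ | inj₁ (refl , _) | inj₁ (refl , _) = contradiction e′ no-loop
    ... | inj₂ _ | inj₂ _ | inj₁ (refl , _) | inj₁ (refl , _) = contradiction e′ no-loop
    ... | inj₁ (refl , ei) | inj₂ (_ , pj , ej) | inj₁ (refl , ei′) | inj₂ (_ , pj′ , ej′)
          rewrite ei | ej | ei′ | ej′ = inj₁ (refl , newNew pj pj′ e e′ (trans swap (trans eq swap)))
    ... | inj₁ (refl , ei) | inj₂ (_ , pj , ej) | inj₂ (_ , pi′ , ei′) | inj₁ (refl , ej′)
          rewrite ei | ej | ei′ | ej′ = inj₂ (refl , newNew pj pi′ e (edge-sym e′) (trans swap eq))
    ... | inj₁ (refl , ei) | inj₂ (_ , pj , ej) | inj₂ (_ , pi′ , ei′) | inj₂ (_ , pj′ , ej′)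
          rewrite ei | ej | ei′ | ej′ = contradiction (trans swap eq) (oldNew pi′ pj′ pj e′ e)
    ... | inj₂ (_ , pi , ei) | inj₁ (refl , ej) | inj₁ (refl , ei′) | inj₂ (_ , pj′ , ej′)
          rewrite ei | ej | ei′ | ej′ = inj₂ (newNew pi pj′ (edge-sym e) e′ (trans eq swap) , refl)
    ... | inj₂ (_ , pi , ei) | inj₁ (refl , ej) | inj₂ (_ , pi′ , ei′) | inj₁ (refl , ej′)
          rewrite ei | ej | ei′ | ej′ = inj₁ (newNew pi pi′ (edge-sym e) (edge-sym e′) eq , refl)
    ... | inj₂ (_ , pi , ei) | inj₁ (refl , ej) | inj₂ (_ , pi′ , ei′) | inj₂ (_ , pj′ , ej′)
          rewrite ei | ej | ei′ | ej′ = contradiction eq (oldNew pi′ pj′ pi e′ (edge-sym e))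
    ... | inj₂ (_ , pi , ei) | inj₂ (_ , pj , ej) | inj₁ (refl , ei′) | inj₂ (_ , pj′ , ej′)
          rewrite ei | ej | ei′ | ej′ = contradiction (trans swap (sym eq)) (oldNew pi pj pj′ e e′)
    ... | inj₂ (_ , pi , ei) | inj₂ (_ , pj , ej) | inj₂ (_ , pi′ , ei′) | inj₁ (refl , ej′)
          rewrite ei | ej | ei′ | ej′ = contradiction (sym eq) (oldNew pi pj pi′ e (edge-sym e′))
    ... | inj₂ (_ , pi , ei) | inj₂ (_ , pj , ej) | inj₂ (_ , pi′ , ei′) | inj₂ (_ , pj′ , ej′)
          rewrite ei | ej | ei′ | ej′ = rainbow pi pj pi′ pj′ e e′ eq

    sparse′ : ∀ {v i j} → Edge H v i → Edge H v j → Placed p′ i → Placed p′ j →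
              A * codegree (place f u y i) (place f u y j) ≤ n
    sparse′ e e′ i< j< with view i< | view j<
    ... | inj₁ (refl , ei)  | inj₁ (refl , _) rewrite ei | codegree-diag y | *-zeroʳ A = z≤n
    ... | inj₁ (refl , ei)  | inj₂ (_ , pj , ej) rewrite ei | ej =
          ≤-trans (*-monoʳ-≤ A (codegree-sym y _)) (compatible (edge-sym e) e′ pj)
    ... | inj₂ (_ , pi , ei) | inj₁ (refl , ej) rewrite ei | ej = compatible (edge-sym e′) e pi
    ... | inj₂ (_ , pi , ei) | inj₂ (_ , pj , ej) rewrite ei | ej = sparse e e′ pi pj

  -- Counting heavy vertices and forbidden images

  heavyCount : List ℕ → ℕ
  heavyCount F = ∑ (allFin n) (λ x → ind (n ℕ.<? A * load F x))

  heavyCount-bound : ∀ F → n * heavyCount F ≤ A * (length F * D)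
  heavyCount-bound F = begin
    n * heavyCount F                   ≤⟨ markov n (allFin n) _ ⟩
    ∑ (allFin n) (λ x → A * load F x)  ≡⟨ ∑-* A (allFin n) _ ⟩
    A * ∑ (allFin n) (load F)          ≤⟨ *-monoʳ-≤ A (∑-load class≤D F) ⟩
    A * (length F * D)                 ∎
    where open ≤-Reasoning

  -- The codegrees at `x` sum to at most `n * D`, and each counted `y` takes more than `n / A` of
  -- this.
  incompatibleCount-bound : .{{_ : ℕ.NonZero n}} → ∀ x →
    ∑ (allFin n) (λ y → ind (n ℕ.<? A * codegree x y)) ≤ A * D
  incompatibleCount-bound x = *-cancelˡ-≤ n (begin
    n * ∑ V (λ y → ind (n ℕ.<? A * codegree x y))  ≤⟨ markov n V _ ⟩
    ∑ V (λ y → A * codegree x y)                   ≡⟨ ∑-* A V _ ⟩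
    A * ∑ V (codegree x)                           ≤⟨ *-monoʳ-≤ A (∑-codegree class≤D x) ⟩
    A * (n * D)                                    ≡⟨ rearrange A n D ⟩
    n * (A * D)                                    ∎)
    where
    open ≤-Reasoning
    V = allFin n
    rearrange : ∀ a n d → a * (n * d) ≡ n * (a * d)
    rearrange = solve-∀

  module Obstruction (p : ℕ) (F : List ℕ) (f : Fin m → Fin n) (u : Fin m) where

    -- Violations of the conditions in `Admissible` are counted with multiplicity, so that the union
    -- bound over all `y` reduces to exchanging sums.
    used repeated incompatible monochromatic obstruction : Fin n → ℕ
    used y          = ∑ (allFin m) (λ i → ind (f i ≟ y))
    repeated y      = ∑ (placedNbrs p u) (λ i → ∑ F (λ c → ind (at? c (f i) y)))
    incompatible y  = ∑ (nbrs u) (λ v → ∑ (placedNbrs p v) (λ j → ind (n ℕ.<? A * codegree (f j) y)))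
    monochromatic y = ∑ (placedNbrs p u) (λ i → ∑ (placedNbrs p u) (λ j → ind (clash? (f i) (f j) y)))
    obstruction y   = used y + (ind (n ℕ.<? A * load F y) + (repeated y + (incompatible y + monochromatic y)))

    admissible : ∀ {y} → obstruction y ≡ 0 → Admissible p F f u y
    admissible {y} eq = record
      { unused     = unused
      ; light      = ind≡0⇒¬ (n ℕ.<? A * load F y) (m+n≡0⇒m≡0 _ eq₁)
      ; newColour  = λ e pi c∈F → ind≡0⇒¬ (at? _ _ y)
          (∑≡0⇒term≡0 _ (∑≡0⇒term≡0 _ (m+n≡0⇒m≡0 _ eq₂) (∈-placedNbrs e pi)) c∈F)
          (unused _ , refl)
      ; distinct   = λ e e′ pi pj same → decidable-stable (_ ≟ _) (λ fi≢fj →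
          ind≡0⇒¬ (clash? _ _ y)
            (∑≡0⇒term≡0 _ (∑≡0⇒term≡0 _ (m+n≡0⇒n≡0 (incompatible y) eq₃) (∈-placedNbrs e pi)) (∈-placedNbrs e′ pj))
            (fi≢fj , unused _ , unused _ , same))
      ; compatible = λ {v} {j} e e′ pj → ≮⇒≥ (ind≡0⇒¬ (n ℕ.<? A * codegree (f j) y)
          (∑≡0⇒term≡0 _ (∑≡0⇒term≡0 _ (m+n≡0⇒m≡0 _ eq₃) (∈-nbrs e)) (∈-placedNbrs e′ pj)))
      }
      where
      eq₁ = m+n≡0⇒n≡0 (used y) eq
      eq₂ = m+n≡0⇒n≡0 (ind (n ℕ.<? A * load F y)) eq₁
      eq₃ = m+n≡0⇒n≡0 (repeated y) eq₂
      unused : ∀ i → f i ≢ y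
      unused i = ind≡0⇒¬ (f i ≟ y) (∑≡0⇒term≡0 _ (m+n≡0⇒m≡0 _ eq) (∈-allFin i))

    private
      V = allFin n
      N = placedNbrs p u

    ∑-used : ∑ V used ≤ m
    ∑-used = begin
      ∑ V used                                           ≡⟨ ∑-swap V (allFin m) _ ⟩
      ∑ (allFin m) (λ i → ∑ V (λ y → ind (f i ≟ y)))     ≤⟨ ∑-bound (allFin m) (λ {i} _ → count-≡ _≟_ (allFin⁺ n) (f i)) ⟩
      length (allFin m) * 1                              ≡⟨ trans (*-identityʳ _) (length-allFin m) ⟩
      m                                                  ∎
      where open ≤-Reasoning

    -- A placed neighbour `i` forbids at most `load F (f i)` images. Its image may be heavy while it
    -- waits to be moved, so the bound `T` is left open here; it will be `2 * n`.
    ∑-repeated : ∀ {T} → (∀ {i} → Placed p i → A * load F (f i) ≤ T) → A * ∑ V repeated ≤ Δ * T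
    ∑-repeated {T} load≤T = begin
      A * ∑ V repeated
        ≡⟨ cong (A *_) (∑-swap V N _) ⟩
      A * ∑ N (λ i → ∑ V (λ y → ∑ F (λ c → ind (at? c (f i) y))))
        ≤⟨ *-monoʳ-≤ A (∑-mono N (λ i → ≤-reflexive (∑-swap V F _))) ⟩
      A * ∑ N (λ i → load F (f i))
        ≡⟨ ∑-* A N _ ⟨
      ∑ N (λ i → A * load F (f i))
        ≤⟨ ∑-bound N (λ i∈N → load≤T (proj₂ (placedNbrs⁻ {p} {u} i∈N))) ⟩
      length N * T
        ≤⟨ *-monoˡ-≤ T (length-placedNbrs p u) ⟩
      Δ * T ∎
      where open ≤-Reasoning

    ∑-incompatible : .{{_ : ℕ.NonZero n}} → ∑ V incompatible ≤ Δ * (Δ * (A * D))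
    ∑-incompatible = begin
      ∑ V incompatible
        ≡⟨ ∑-swap V (nbrs u) _ ⟩
      ∑ (nbrs u) (λ v → ∑ V (λ y → ∑ (placedNbrs p v) (λ j → ind (n ℕ.<? A * codegree (f j) y))))
        ≤⟨ ∑-bound (nbrs u) (λ {v} _ → second v) ⟩
      length (nbrs u) * (Δ * (A * D))
        ≤⟨ *-monoˡ-≤ (Δ * (A * D)) (deg≤Δ u) ⟩
      Δ * (Δ * (A * D)) ∎
      where
      open ≤-Reasoning
      second : ∀ v → ∑ V (λ y → ∑ (placedNbrs p v) (λ j → ind (n ℕ.<? A * codegree (f j) y))) ≤ Δ * (A * D)
      second v = begin
        _                                 ≡⟨ ∑-swap V (placedNbrs p v) _ ⟩
        _                                 ≤⟨ ∑-bound (placedNbrs p v) (λ {j} _ → incompatibleCount-bound (f j)) ⟩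
        length (placedNbrs p v) * (A * D) ≤⟨ *-monoˡ-≤ (A * D) (length-placedNbrs p v) ⟩
        Δ * (A * D)                       ∎

    -- Here `sparse` pays off: two placed neighbours of `u` have the common neighbour `u`, so the
    -- codegree of their images is at most `n / A`.
    ∑-monochromatic : Partial p F f → A * ∑ V monochromatic ≤ Δ * (Δ * n)
    ∑-monochromatic partl = begin
      A * ∑ V monochromatic
        ≡⟨ cong (A *_) (∑-swap V N _) ⟩
      A * ∑ N (λ i → ∑ V (λ y → ∑ N (λ j → ind (clash? (f i) (f j) y))))
        ≤⟨ *-monoʳ-≤ A (∑-mono N (λ i → ≤-reflexive (∑-swap V N _))) ⟩
      A * ∑ N (λ i → ∑ N (λ j → codegree (f i) (f j)))
        ≡⟨ ∑-* A N _ ⟨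
      ∑ N (λ i → A * ∑ N (λ j → codegree (f i) (f j)))
        ≤⟨ ∑-bound N (λ {i} i∈N → row (placedNbrs⁻ {p} {u} i∈N)) ⟩
      length N * (Δ * n)
        ≤⟨ *-monoˡ-≤ (Δ * n) (length-placedNbrs p u) ⟩
      Δ * (Δ * n) ∎
      where
      open ≤-Reasoning
      row : ∀ {i} → Edge H u i × Placed p i → A * ∑ N (λ j → codegree (f i) (f j)) ≤ Δ * n
      row {i} (e , pi) = begin
        A * ∑ N (λ j → codegree (f i) (f j))  ≡⟨ ∑-* A N _ ⟨
        ∑ N (λ j → A * codegree (f i) (f j))  ≤⟨ ∑-bound N (λ j∈N → let (e′ , pj) = placedNbrs⁻ {p} {u} j∈N in
                                                   Partial.sparse partl e e′ pi pj) ⟩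
        length N * n                          ≤⟨ *-monoˡ-≤ n (length-placedNbrs p u) ⟩
        Δ * n                                 ∎

  -- Nothing is asked of the old image of `u`, which after a move is itself marked as abandoned.
  place-light : ∀ {p p′ u y} {f : Fin m → Fin n} → (∀ i → Placed p′ i → i ≡ u ⊎ Placed p i) →
                (Q : Fin n → Set) → Q y → (∀ {i} → i ≢ u → Placed p i → Q (f i)) →
                ∀ {i} → Placed p′ i → Q (place f u y i)
  place-light {p} {p′} {u} {y} {f} grow Q Qy Qf {i} i<p′ with placeView {p} {p′} {f} {u} {y} grow i<p′
  ... | inj₁ (_ , eq)         = subst Q (sym eq) Qy
  ... | inj₂ (i≢u , i<p , eq) = subst Q (sym eq) (Qf i≢u i<p)

  load-extend : ∀ p F f u y x → A * load (newColours p f u y ++ F) x ≤ A * load F x + E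
  load-extend p F f u y x = begin
    A * load (N ++ F) x               ≡⟨ cong (A *_) (∑-++ N F _) ⟩
    A * (load N x + load F x)         ≡⟨ *-distribˡ-+ A _ _ ⟩
    A * load N x + A * load F x       ≡⟨ +-comm (A * load N x) _ ⟩
    A * load F x + A * load N x       ≤⟨ +-monoʳ-≤ _ (*-monoʳ-≤ A (≤-trans (load≤ class≤D N x) (*-monoˡ-≤ D lengthN))) ⟩
    A * load F x + E                  ∎
    where
    open ≤-Reasoning
    N = newColours p f u y
    lengthN : length N ≤ Δ
    lengthN = ≤-trans (≤-reflexive (length-map _ (placedNbrs p u))) (length-placedNbrs p u)

  length-extend : ∀ p F f u y {s} → length F ≤ Δ * s → length (newColours p f u y ++ F) ≤ Δ * suc s
  length-extend p F f u y {s} F≤ = begin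
    length (N ++ F)        ≡⟨ length-++ N ⟩
    length N + length F    ≤⟨ +-mono-≤ (≤-trans (≤-reflexive (length-map _ (placedNbrs p u))) (length-placedNbrs p u)) F≤ ⟩
    Δ + Δ * s              ≡⟨ *-suc Δ s ⟨
    Δ * suc s              ∎
    where
    open ≤-Reasoning
    N = newColours p f u y

  -- Sets of abandoned vertices, and the process of moves and additions

  size : (Fin n → Bool) → ℕ
  size G = ∑ (allFin n) (λ x → ind (G x Bool.≟ true))

  size≤n : ∀ G → size G ≤ n
  size≤n G = begin
    size G                   ≤⟨ ∑-bound (allFin n) (λ {x} _ → ind≤1 (G x Bool.≟ true)) ⟩
    length (allFin n) * 1    ≡⟨ trans (*-identityʳ _) (length-allFin n) ⟩
    n                        ∎
    where open ≤-Reasoning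

  insert : Fin n → (Fin n → Bool) → Fin n → Bool
  insert x G z = does (z ≟ x) ∨ G z

  ∈-insert⁻ : ∀ {x G z} → insert x G z ≡ true → z ≡ x ⊎ G z ≡ true
  ∈-insert⁻ {x} {G} {z} eq with z ≟ x
  ... | yes z≡x = inj₁ z≡x
  ... | no _    = inj₂ eq

  ∉-insert : ∀ {x G z} → z ≢ x → G z ≡ false → insert x G z ≡ false
  ∉-insert {x} {G} {z} z≢x eq with z ≟ x
  ... | yes z≡x = contradiction z≡x z≢x
  ... | no _    = eq

  insert-self : ∀ x G → insert x G x ≡ true
  insert-self x G with x ≟ x
  ... | yes _  = refl
  ... | no x≢x = contradiction refl x≢x

  insert-mono : ∀ x G {z} → G z ≡ true → insert x G z ≡ true
  insert-mono x G {z} eq with z ≟ x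
  ... | yes _ = refl
  ... | no _  = eq

  size-insert : ∀ {x G} → G x ≡ false → suc (size G) ≤ size (insert x G)
  size-insert {x} {G} Gx≡false = ∑-mono-<
    (λ z → ind-mono (insert-mono x G) (G z Bool.≟ true) (insert x G z Bool.≟ true))
    (∈-allFin x)
    (≤-reflexive (trans (cong suc (ind-no (G x Bool.≟ true) (λ eq → false≢true (trans (sym Gx≡false) eq))))
                        (sym (ind-yes (insert x G x Bool.≟ true) (insert-self x G)))))
    where
    false≢true : false ≢ true
    false≢true ()

  -- G marks the vertices of K_n from which a vertex of H has been moved away; p + size G then counts
  -- the placements, and each move adds at most E to A * load, whence the bound in loaded.
  record State (p : ℕ) (G : Fin n → Bool) (F : List ℕ) (f : Fin m → Fin n) : Set where
    field
      partl   : Partial p F f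
      length≤ : length F ≤ Δ * (p + size G)
      avoided : ∀ {i} → Placed p i → G (f i) ≡ false
      heavy   : ∀ {x} → G x ≡ true → Heavy F x
      loaded  : ∀ {i} → Placed p i → A * load F (f i) ≤ n + suc (size G) * E

  -- `room` compares `A` times the five bounds from `Obstruction`, with `T = 2 * n`, to `A * n`.
  -- `slack` says that the loads gained in a burst of at most `2 * E` moves and one further
  -- placement stay below another `n`.
  module Process
    .{{_ : ℕ.NonZero n}}
    (room  : A * m + (A * (2 * E) + (Δ * (2 * n) + (A * (Δ * (Δ * (A * D))) + Δ * (Δ * n)))) < A * n)
    (slack : suc (2 * E) * E ≤ n)
    where

    m<n : m < n
    m<n = *-cancelˡ-< A m n (≤-<-trans (m≤m+n (A * m) _) room)

    -- A bootstrap: the crude `size G ≤ n` bounds the length of `F` by `2 * Δ * n`, hence the number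
    -- of heavy vertices by `2 * E`. As `G` consists of heavy vertices, `size≤` then improves the
    -- crude bound.
    heavyCount≤ : ∀ {p G F f} → p ≤ m → State p G F f → heavyCount F ≤ 2 * E
    heavyCount≤ {p} {G} {F} p≤m st = *-cancelˡ-≤ n (begin
      n * heavyCount F                ≤⟨ heavyCount-bound F ⟩
      A * (length F * D)              ≤⟨ *-monoʳ-≤ A (*-monoˡ-≤ D (State.length≤ st)) ⟩
      A * (Δ * (p + size G) * D)      ≤⟨ *-monoʳ-≤ A (*-monoˡ-≤ D (*-monoʳ-≤ Δ
                                           (+-mono-≤ (≤-trans p≤m (<⇒≤ m<n)) (size≤n G)))) ⟩
      A * (Δ * (n + n) * D)           ≡⟨ rearrange A Δ D n ⟩
      n * (2 * E)                     ∎)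
      where
      open ≤-Reasoning
      rearrange : ∀ a δ d n → a * (δ * (n + n) * d) ≡ n * (2 * (a * (δ * d)))
      rearrange = solve-∀

    size≤ : ∀ {p G F f} → p ≤ m → State p G F f → size G ≤ 2 * E
    size≤ {G = G} {F} p≤m st = ≤-trans
      (∑-mono (allFin n) (λ x → ind-mono (State.heavy st) (G x Bool.≟ true) (n ℕ.<? A * load F x)))
      (heavyCount≤ p≤m st)

    load≤2n : ∀ {p G F f} → p ≤ m → State p G F f → ∀ {i} → Placed p i → A * load F (f i) ≤ 2 * n
    load≤2n {G = G} p≤m st pi = ≤-trans (State.loaded st pi) (+-monoʳ-≤ n
      (≤-trans (*-monoˡ-≤ E (s≤s (size≤ p≤m st))) (≤-trans slack (≤-reflexive (sym (+-identityʳ n))))))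

    choose : ∀ {p G F f} → p ≤ m → State p G F f → ∀ u → ∃[ y ] Admissible p F f u y
    choose {p} {G} {F} {f} p≤m st u = let (y , eq) = vanishing-term V obstruction few in y , admissible eq
      where
      open Obstruction p F f u
      open ≤-Reasoning
      V = allFin n

      total : A * ∑ V obstruction < A * n
      total = begin-strict
        A * ∑ V obstruction
          ≡⟨ cong (A *_) (trans (∑-+ V used _) (cong (∑ V used +_) (trans (∑-+ V _ _) (cong (heavyCount F +_)
               (trans (∑-+ V repeated _) (cong (∑ V repeated +_) (∑-+ V incompatible monochromatic))))))) ⟩
        A * (∑ V used + (heavyCount F + (∑ V repeated + (∑ V incompatible + ∑ V monochromatic))))
          ≡⟨ distribute A (∑ V used) (heavyCount F) (∑ V repeated) (∑ V incompatible) (∑ V monochromatic) ⟩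
        A * ∑ V used + (A * heavyCount F + (A * ∑ V repeated + (A * ∑ V incompatible + A * ∑ V monochromatic)))
          ≤⟨ +-mono-≤ (*-monoʳ-≤ A ∑-used) (+-mono-≤ (*-monoʳ-≤ A (heavyCount≤ p≤m st))
               (+-mono-≤ (∑-repeated (load≤2n p≤m st)) (+-mono-≤ (*-monoʳ-≤ A ∑-incompatible)
                 (∑-monochromatic (State.partl st))))) ⟩
        A * m + (A * (2 * E) + (Δ * (2 * n) + (A * (Δ * (Δ * (A * D))) + Δ * (Δ * n))))
          <⟨ room ⟩
        A * n ∎
        where
        distribute : ∀ a b c d e g → a * (b + (c + (d + (e + g)))) ≡ a * b + (a * c + (a * d + (a * e + a * g)))
        distribute = solve-∀

      few : ∑ V obstruction < length V
      few = subst (∑ V obstruction <_) (sym (length-allFin n)) (*-cancelˡ-< A _ _ total)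

    G≡false : ∀ {p G F f y} → State p G F f → ¬ Heavy F y → G y ≡ false
    G≡false st light = ¬-not (light ∘ State.heavy st)

    move : ∀ {p G F f u y} → State p G F f → Placed p u → Heavy F (f u) → Admissible p F f u y →
           ∃[ F′ ] ∃[ f′ ] State p (insert (f u) G) F′ f′
    move {p} {G} {F} {f} {u} {y} st pu hu adm = F′ , place f u y , record
      { partl   = extend stay partl adm
      ; length≤ = ≤-trans (length-extend p F f u y length≤) (*-monoʳ-≤ Δ grown)
      ; avoided = place-light {p = p} stay (λ z → insert (f u) G z ≡ false)
          (∉-insert {f u} {G} (unused u ∘ sym) (G≡false st light))
          (λ i≢u pi → ∉-insert {f u} {G} (i≢u ∘ Partial.inj partl pi pu) (avoided pi))
      ; heavy   = λ {x} x∈ → still-heavy (∈-insert⁻ {f u} {G} x∈)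
      -- The new image was light, so it exceeds `n` by at most `E`. For the other vertices the
      -- additional `E` is paid for by the growth of `size G`.
      ; loaded  = place-light {p = p} stay (λ z → A * load F′ z ≤ n + suc (size G′) * E)
          (≤-trans (load-extend p F f u y y) (≤-trans (+-monoˡ-≤ E (≮⇒≥ light))
            (+-monoʳ-≤ n (m≤m+n E _))))
          (λ {i} _ pi → ≤-trans (load-extend p F f u y (f i)) (≤-trans (+-monoˡ-≤ E (loaded pi))
            (≤-trans (≤-reflexive (shift n (suc (size G) * E) E)) (+-monoʳ-≤ n (+-monoʳ-≤ E (*-monoˡ-≤ E (size-insert (avoided pu))))))))
      }
      where
      open State st
      open Admissible adm
      F′ = newColours p f u y ++ F
      G′ = insert (f u) G
      stay : ∀ i → Placed p i → i ≡ u ⊎ Placed p i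
      stay i = inj₂
      grown : suc (p + size G) ≤ p + size G′
      grown = ≤-trans (≤-reflexive (sym (+-suc p (size G)))) (+-monoʳ-≤ p (size-insert (avoided pu)))
      mono : ∀ {x} → Heavy F x → Heavy F′ x
      mono {x} h = ≤-trans h (*-monoʳ-≤ A (load-mono (newColours p f u y) x))
      still-heavy : ∀ {x} → x ≡ f u ⊎ G x ≡ true → Heavy F′ x
      still-heavy (inj₁ refl) = mono hu
      still-heavy (inj₂ x∈G)  = mono (heavy x∈G)
      shift : ∀ a b c → (a + b) + c ≡ a + (c + b)
      shift = solve-∀

    -- Additions happen only when all placed images are light. Each `A * load` is then at most `n`
    -- before the step and at most `n + E` after it, so that additions do not accumulate in
    -- `loaded`.
    add : ∀ {p G F f y} (p<m : p < m) → State p G F f → (∀ {i} → Placed p i → ¬ Heavy F (f i)) →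
          Admissible p F f (fromℕ< p<m) y → ∃[ F′ ] ∃[ f′ ] State (suc p) G F′ f′
    add {p} {G} {F} {f} {y} p<m st lights adm = F′ , place f u y , record
      { partl   = extend grow partl adm
      ; length≤ = length-extend p F f u y length≤
      ; avoided = place-light {p = p} grow (λ z → G z ≡ false) (G≡false st light) (λ _ → avoided)
      ; heavy   = λ {x} x∈G → ≤-trans (heavy x∈G) (*-monoʳ-≤ A (load-mono (newColours p f u y) x))
      ; loaded  = place-light {p = p} grow (λ z → A * load F′ z ≤ n + suc (size G) * E)
          (bound light) (λ _ pi → bound (lights pi))
      }
      where
      open State st
      open Admissible adm
      u = fromℕ< p<m
      F′ = newColours p f u y ++ F
      grow : ∀ i → Placed (suc p) i → i ≡ u ⊎ Placed p i
      grow i i<1+p with m≤n⇒m<n∨m≡n (s≤s⁻¹ i<1+p)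
      ... | inj₁ i<p = inj₂ i<p
      ... | inj₂ i≡p = inj₁ (toℕ-injective (trans i≡p (sym (toℕ-fromℕ< p<m))))
      bound : ∀ {x} → ¬ Heavy F x → A * load F′ x ≤ n + suc (size G) * E
      bound {x} lx = ≤-trans (load-extend p F f u y x)
        (≤-trans (+-monoˡ-≤ E (≮⇒≥ lx)) (+-monoʳ-≤ n (m≤m+n E _)))

    -- Every step raises `p + size G`, which never exceeds `m + n`; this bounds the number of steps.
    -- Moves take precedence, and a vertex is added only when no placed image is heavy.
    run : ∀ fuel {p G F f} → p ≤ m → m + n < fuel + (p + size G) → State p G F f → HPolychromatic H φ
    run zero {G = G} p≤m out st = contradiction (≤-trans out (+-mono-≤ p≤m (size≤n G))) (<-irrefl refl)
    run (suc fuel) {p} {G} {F} {f} p≤m enough st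
      with any? (λ i → (toℕ i ℕ.<? p) ×-dec (n ℕ.<? A * load F (f i)))
    ... | yes (u , pu , hu) = let (_ , _ , st′) = move st pu hu (proj₂ (choose p≤m st u)) in
          run fuel p≤m (≤-trans enough (≤-trans (≤-reflexive (shift fuel p (size G)))
            (+-monoʳ-≤ fuel (+-monoʳ-≤ p (size-insert (State.avoided st pu)))))) st′
      where
      shift : ∀ a b c → suc a + (b + c) ≡ a + (b + suc c)
      shift = solve-∀
    ... | no ¬heavy with p ℕ.<? m
    ...   | yes p<m = let (_ , _ , st′) = add p<m st (λ {i} pi hi → ¬heavy (i , pi , hi))
                                      (proj₂ (choose p≤m st (fromℕ< p<m))) in
            run fuel p<m (≤-trans enough (≤-reflexive (sym (+-suc fuel (p + size G))))) st′
    ...   | no p≮m = f , inj all all , λ i j i′ j′ → rainbow all all all all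
      where
      open Partial (State.partl st)
      all : ∀ {i} → Placed p i
      all {i} = ≤-trans (toℕ<n i) (≮⇒≥ p≮m)

    polychromatic : HPolychromatic H φ
    -- Nothing is placed at the start, so the values of `f` are mere defaults; the inclusion of
    -- `Fin m` supplies them.
    polychromatic = run (suc (m + n)) {0} {λ _ → false} {[]} {λ i → inject≤ i (<⇒≤ m<n)} z≤n (m≤m+n (suc (m + n)) _) record
      { partl   = record { inj = λ () ; recorded = λ () ; rainbow = λ () ; sparse = λ _ _ () }
      ; length≤ = z≤n
      ; avoided = λ ()
      ; heavy   = λ ()
      ; loaded  = λ ()
      }

-- Choice of the constants

module Constants (e Δ : ℕ) (1≤Δ : 1 ≤ Δ) where

  -- A graph on m vertices leaves n / e spare ones. The proportions in the header are 1 / A: then repeated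
  -- colours forbid at most 2Δn / A images and equal colours on two new edges Δ²n / A, together below n / 2e.
  -- K makes 3E² ≤ n, which absorbs all terms of order k and k².
  A K : ℕ
  A = 8 * (Δ * Δ) * e
  K = suc (4 * (A * Δ))

  module _ {m n k} .{{_ : ℕ.NonZero n}} (spare : e * m + n ≤ e * n) (K²k²≤n : (K * k) * (K * k) ≤ n) where

    private
      D = 2 * k
      E = A * (Δ * D)

    m≤m² : ∀ x → x ≤ x * x
    m≤m² zero    = z≤n
    m≤m² (suc x) = m≤m*n (suc x) (suc x)

    3E²≤n : 3 * (E * E) ≤ n
    3E²≤n = begin
      -- `2 * E` equals `4 * (A * Δ) * k`, which is at most `K * k`; hence three is rounded up to
      -- the square four.
      3 * (E * E)                                      ≤⟨ *-monoˡ-≤ (E * E) (s≤s (s≤s (s≤s (z≤n {1})))) ⟩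
      4 * (E * E)                                      ≡⟨ rearrange A Δ k ⟩
      (4 * (A * Δ) * k) * (4 * (A * Δ) * k)            ≤⟨ *-mono-≤ Kk Kk ⟩
      (K * k) * (K * k)                                ≤⟨ K²k²≤n ⟩
      n                                                ∎
      where
      open ≤-Reasoning
      Kk = *-monoˡ-≤ k (n≤1+n (4 * (A * Δ)))
      rearrange : ∀ a δ k → 4 * ((a * (δ * (2 * k))) * (a * (δ * (2 * k)))) ≡ (4 * (a * δ) * k) * (4 * (a * δ) * k)
      rearrange = solve-∀

    slack : suc (2 * E) * E ≤ n
    slack = begin
      E + 2 * E * E           ≤⟨ +-monoˡ-≤ (2 * E * E) (m≤m² E) ⟩
      E * E + 2 * E * E       ≡⟨ rearrange E ⟩
      3 * (E * E)             ≤⟨ 3E²≤n ⟩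
      n                       ∎
      where
      open ≤-Reasoning
      rearrange : ∀ x → x * x + 2 * x * x ≡ 3 * (x * x)
      rearrange = solve-∀

    -- By `spare`, `A * n` exceeds `A * m` by at least eight parts of size `Δ * Δ * n`. The terms of
    -- order `k` are at most `3 * (E * E)` and fit into one part, the repeated colours take two and
    -- the equal new colours one. The four parts left over give strictness.
    room : A * m + (A * (2 * E) + (Δ * (2 * n) + (A * (Δ * (Δ * (A * D))) + Δ * (Δ * n)))) < A * n
    room = begin-strict
      A * m + (A * (2 * E) + (Δ * (2 * n) + (A * (Δ * (Δ * (A * D))) + Δ * (Δ * n))))
        ≡⟨ regroup A Δ D m n ⟩
      A * m + ((2 * (A * A * (Δ * D)) + A * A * (Δ * Δ) * D) + 2 * Δ * n + Δ * Δ * n)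
        ≤⟨ +-monoʳ-≤ (A * m) (+-monoˡ-≤ (Δ * Δ * n) (+-mono-≤ few (*-monoˡ-≤ n (*-monoʳ-≤ 2 (m≤m² Δ))))) ⟩
      A * m + (n + 2 * (Δ * Δ) * n + Δ * Δ * n)
        ≤⟨ +-monoʳ-≤ (A * m) (+-monoˡ-≤ (Δ * Δ * n) (+-monoˡ-≤ (2 * (Δ * Δ) * n) n≤Δ²n)) ⟩
      A * m + (Δ * Δ * n + 2 * (Δ * Δ) * n + Δ * Δ * n)
        <⟨ +-monoʳ-< (A * m) (m<m+n _ (≤-trans (ℕ.>-nonZero⁻¹ n) (≤-trans n≤Δ²n (m≤m+n _ (3 * (Δ * Δ * n)))))) ⟩
      A * m + ((Δ * Δ * n + 2 * (Δ * Δ) * n + Δ * Δ * n) + 4 * (Δ * Δ * n))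
        ≡⟨ collect Δ e m n ⟩
      8 * (Δ * Δ) * (e * m + n)
        ≤⟨ *-monoʳ-≤ (8 * (Δ * Δ)) spare ⟩
      8 * (Δ * Δ) * (e * n)
        ≡⟨ *-assoc (8 * (Δ * Δ)) e n ⟨
      A * n ∎
      where
      open ≤-Reasoning
      regroup : ∀ a δ d m n →
        a * m + (a * (2 * (a * (δ * d))) + (δ * (2 * n) + (a * (δ * (δ * (a * d))) + δ * (δ * n)))) ≡
        a * m + ((2 * (a * a * (δ * d)) + a * a * (δ * δ) * d) + 2 * δ * n + δ * δ * n)
      regroup = solve-∀
      collect : ∀ δ e m n →
        8 * (δ * δ) * e * m + ((δ * δ * n + 2 * (δ * δ) * n + δ * δ * n) + 4 * (δ * δ * n)) ≡ 8 * (δ * δ) * (e * m + n)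
      collect = solve-∀
      square : ∀ a δ d → 2 * (a * a * ((δ * d) * (δ * d))) + a * a * (δ * δ) * (d * d) ≡ 3 * ((a * (δ * d)) * (a * (δ * d)))
      square = solve-∀
      n≤Δ²n : n ≤ Δ * Δ * n
      n≤Δ²n = ≤-trans (≤-reflexive (sym (*-identityˡ n))) (*-monoˡ-≤ n (*-mono-≤ 1≤Δ 1≤Δ))
      few : 2 * (A * A * (Δ * D)) + A * A * (Δ * Δ) * D ≤ n
      few = begin
        2 * (A * A * (Δ * D)) + A * A * (Δ * Δ) * D
          ≤⟨ +-mono-≤ (*-monoʳ-≤ 2 (*-monoʳ-≤ (A * A) (m≤m² (Δ * D)))) (*-monoʳ-≤ (A * A * (Δ * Δ)) (m≤m² D)) ⟩
        2 * (A * A * ((Δ * D) * (Δ * D))) + A * A * (Δ * Δ) * (D * D)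
          ≡⟨ square A Δ D ⟩
        3 * (E * E)
          ≤⟨ 3E²≤n ⟩
        n ∎

theorem3p1 : (η : ℚ) → Positive η → (Δ : ℕ) → 2 ≤ Δ →
    Σ ℚ λ β → Σ ℚ λ κ → Positive β × Positive κ × ∃[ n₀ ] ((n : ℕ) → n₀ ≤ n →
    (m : ℕ) → ℕ→ℚ m ≤ℚ (1ℚ -ℚ η) *ℚ ℕ→ℚ n →
    (H : Graph m) → InH2 H (β *ℚ ℕ→ℚ n) Δ →
    (k : ℕ) → ℕ→ℚ (k ^ Δ * ⌊log₂ n ⌋) ≤ℚ (κ ^ℚ Δ) *ℚ ℕ→ℚ n →
    (φ : EdgeColouring n) → KBounded k φ → HPolychromatic H φ)
theorem3p1 η η>0 Δ 2≤Δ with clear-denominator η η>0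
-- `suc e` is the denominator of `η`, so `η n` is at least `n / suc e`. The threshold two makes the
-- logarithm of `n` at least one.
... | e , c , eη≡c = 1ℚ , κ , _ , ℚ.1/pos⇒pos (ℕ→ℚ K) , 2 , embed
  where
  open Constants (suc e) Δ (<⇒≤ 2≤Δ)
  instance
    K-positive : Positive (ℕ→ℚ K)
    K-positive = ℕ→ℚ-pos (4 * (A * Δ))
    K-nonZero : ℚ.NonZero (ℕ→ℚ K)
    K-nonZero = ℚ.pos⇒nonZero (ℕ→ℚ K)
  κ = ℚ.1/ ℕ→ℚ K
  embed : (n : ℕ) → 2 ≤ n → (m : ℕ) → ℕ→ℚ m ≤ℚ (1ℚ -ℚ η) *ℚ ℕ→ℚ n →
          (H : Graph m) → InH2 H (1ℚ *ℚ ℕ→ℚ n) Δ →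
          (k : ℕ) → ℕ→ℚ (k ^ Δ * ⌊log₂ n ⌋) ≤ℚ (κ ^ℚ Δ) *ℚ ℕ→ℚ n →
          (φ : EdgeColouring n) → KBounded k φ → HPolychromatic H φ
  embed n 2≤n m m≤ H (_ , deg≤Δ , _) k k≤ φ bounded = polychromatic
    where
    instance
      n-nonZero : ℕ.NonZero n
      n-nonZero = ℕ.>-nonZero (<⇒≤ 2≤n)
    spare : suc e * m + n ≤ suc e * n
    spare = spare-vertices {η} {suc e} {c} eη≡c m n m≤
    K²k²≤n : (K * k) * (K * k) ≤ n
    K²k²≤n = square-bound {κ} {K} (ℚ.*-inverseʳ (ℕ→ℚ K)) 2≤Δ 2≤n k k≤
    open Embedding H φ Δ A (2 * k) deg≤Δ (Colouring.handshake φ bounded)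
    open Process (room {m} {n} {k} spare K²k²≤n) (slack {m} {n} {k} spare K²k²≤n)
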